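{- For every integer $k \ge 1$ and every integer $d \ge 2$, there exists a $k$-SI graph $G$ with $\operatorname{diam}(G) = d$.
   Context: Graphs are finite and simple. For a positive integer $k$, a graph $G$ is a $k$-stepwise irregular graph ($k$-SI graph) if $|d_G(u) - d_G(v)| = k$ for every edge $uv \in E(G)$, where $d_G(x)$ is the degree of $x$ in $G$. The diameter $\operatorname{diam}(G)$ is the maximum distance between two vertices of $G$; saying that $G$ has diameter $d$ (a finite number) includes that $G$ is connected. -}

module Defs where

open import Data.List.Base using (List; length; filter)
open import Data.List.Membership.Propositional using (_∈_)
open import Data.List.Relation.Unary.Unique.Propositional using (Unique)
open import Data.Nat.Base using (ℕ; zero; suc; _≤_; ∣_-_∣)
open import Data.Product.Base using (_×_; ∃-syntax)
open import Level using (0ℓ)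
open import Relation.Binary.Core using (Rel)
open import Relation.Binary.Definitions using (Decidable; Irreflexive; Symmetric)
open import Relation.Binary.PropositionalEquality.Core using (_≡_)

-- A finite simple graph. Finiteness is given by a duplicate-free list of all
-- vertices. Adj need not be proof-irrelevant: only whether it is inhabited
-- matters for everything below, so there are no multiple edges.
record Graph : Set₁ where
  field
    V        : Set
    vertices : List V
    complete : ∀ v → v ∈ vertices
    unique   : Unique vertices
    Adj      : Rel V 0ℓ
    Adj?     : Decidable Adj
    sym      : Symmetric Adj
    irrefl   : Irreflexive _≡_ Adj

  degree : V → ℕ
  degree v = length (filter (Adj? v) vertices)

  data Walk : V → V → ℕ → Set where
    []  : ∀ {u} → Walk u u zero
    _∷_ : ∀ {u v w n} → Adj u v → Walk v w n → Walk u w (suc n)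

  -- Distance is a relation because it is undefined (infinite) between
  -- vertices in different components.
  IsDistance : V → V → ℕ → Set
  IsDistance u v m = Walk u v m × (∀ n → Walk u v n → m ≤ n)

  -- The first component makes all distances finite, so G is connected; the
  -- second says that the bound d is attained, so G has at least one vertex.
  IsDiameter : ℕ → Set
  IsDiameter d =
    (∀ u v → ∃[ m ] (IsDistance u v m × m ≤ d)) ×
    (∃[ u ] ∃[ v ] IsDistance u v d)

  IsStepwiseIrregular : ℕ → Set
  IsStepwiseIrregular k = ∀ u v → Adj u v → ∣ degree u - degree v ∣ ≡ k

{-# OPTIONS --safe #-}
-- Blowing up each vertex of a weighted graph into an independent set turns
-- weighted degrees into degrees and keeps distances other than those between
-- twins. Multiplying all weights by k multiplies all degree differences by k,
-- so only k = 1 matters. For d ≠ 3 the weighted graph is a path with d + 1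
-- vertices: writing 0 before and after its weights, every four consecutive
-- weights a, b, c, e must satisfy |(a + c) - (b + e)| = 1, a condition that
-- survives repeating the first four weights, so d = 2 and d = 4, …, 7
-- suffice. No weighting of the path works for d = 3; there, take K₄,₄ minus a
-- perfect matching.
module Submission where

open import Defs
open import Data.Bool.Base using (Bool; true; false; not)
import Data.Bool.Properties as Bool
open import Data.Empty using (⊥-elim)
open import Data.Fin.Base using (Fin; zero; suc; fromℕ<)
import Data.Fin.Properties as Fin
open import Data.List.Base using
  (List; []; _∷_; length; map; concatMap; filter; upTo; allFin; cartesianProduct)
open import Data.List.Membership.Propositional using (_∈_; lose; find)
open import Data.List.Membership.Propositional.Properties using
  (∈-map⁺; ∈-map⁻; ∈-concatMap⁺; ∈-concatMap⁻; ∈-filter⁺; ∈-filter⁻; ∈-allFin;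
   ∈-upTo⁺; ∈-cartesianProduct⁺)
open import Data.List.Membership.Propositional.Properties.WithK using (unique∧set⇒bag)
import Data.List.Membership.DecPropositional as DecMembership
open import Data.List.Properties using (length-++; length-map; length-tabulate)
open import Data.List.Relation.Binary.BagAndSetEquality using (∼bag⇒↭)
open import Data.List.Relation.Binary.Permutation.Propositional.Properties using (↭-length)
open import Data.List.Relation.Unary.All as All using (All; []; _∷_)
import Data.List.Relation.Unary.All.Properties as All
open import Data.List.Relation.Unary.AllPairs as AllPairs using ([]; _∷_)
import Data.List.Relation.Unary.AllPairs.Properties as AllPairs
open import Data.List.Relation.Unary.Any using (here; there; any?)
open import Data.List.Relation.Unary.Unique.Propositional using (Unique)
import Data.List.Relation.Unary.Unique.Propositional.Properties as Unique
open import Data.Nat.Base using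
  (ℕ; zero; suc; _+_; _*_; _≤_; _<_; ∣_-_∣; z≤n; s≤s; s≤s⁻¹)
open import Data.Nat.Induction using (<-rec)
open import Data.Nat.ListAction using (sum)
open import Data.Nat.Properties renaming (_≟_ to _≟ℕ_)
open import Data.Product.Base using (Σ; _×_; _,_; proj₁; proj₂; ∃-syntax)
open import Data.Product.Properties using (≡-dec)
open import Function.Base using (_∘_; id)
open import Function.Bundles using (mk⇔)
open import Relation.Binary.Definitions using (DecidableEquality; tri<; tri≈; tri>)
open import Relation.Binary.PropositionalEquality
open import Relation.Nullary.Decidable using (Dec; yes; no; map′; _×-dec_; ¬?; from-yes; True; toWitness)
open import Relation.Nullary.Negation using (¬_)
open import Relation.Unary using (Pred; Decidable)

-- Shortest walks and the diameter of a finite graph.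

-- Turns any walk into a shortest one: minimality is the second half of `IsDistance`.
least : ∀ {p} {P : Pred ℕ p} → Decidable P → ∀ n → P n →
  ∃[ m ] (m ≤ n × P m × (∀ l → P l → m ≤ l))
least {P = P} P? = <-rec _ go
  where
  Least : ℕ → Set _
  Least n = P n → ∃[ m ] (m ≤ n × P m × (∀ l → P l → m ≤ l))

  go : ∀ n → (∀ {m} → m < n → Least m) → Least n
  go n rec pn with anyUpTo? P? n
  ... | yes (m , m<n , pm) =
    let l , l≤m , pl , min = rec m<n pm in l , ≤-trans l≤m (<⇒≤ m<n) , pl , min
  ... | no none = n , ≤-refl , pn , λ l pl → ≮⇒≥ λ l<n → none (l , l<n , pl)

module _ (G : Graph) where
  open Graph G

  walk? : DecidableEquality V → ∀ u v n → Dec (Walk u v n)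
  walk? _≟_ u v zero = map′ (λ { refl → [] }) (λ { [] → refl }) (u ≟ v)
  walk? _≟_ u v (suc n) =
    map′ (λ p → let w , _ , uw∷wv = find p in proj₁ uw∷wv ∷ proj₂ uw∷wv)
         (λ { (_∷_ {v = w} uw wv) → lose (complete w) (uw , wv) })
         (any? (λ w → Adj? u w ×-dec walk? _≟_ w v n) vertices)

  -- A height that rises by at most one per edge bounds walk lengths from below, without enumerating
  -- walks.
  height-walk : (h : V → ℕ) → (∀ u v → Adj u v → h v ≤ suc (h u)) →
    ∀ {u v n} → Walk u v n → h v ≤ n + h u
  height-walk h lip [] = ≤-refl
  height-walk h lip {u} {v} (_∷_ {v = w} {n = n} uw wv) = begin
    h v            ≤⟨ height-walk h lip wv ⟩
    n + h w        ≤⟨ +-monoʳ-≤ n (lip u w uw) ⟩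
    n + suc (h u)  ≡⟨ +-suc n (h u) ⟩
    suc n + h u    ∎
    where open ≤-Reasoning

  -- A certificate for the diameter: the walks, not necessarily shortest, give the upper bound, and
  -- a pair whose heights differ by `d` gives the lower bound.
  isDiameter : DecidableEquality V → ∀ d →
    (∀ u v → ∃[ n ] (n ≤ d × Walk u v n)) →
    (h : V → ℕ) → (∀ u v → Adj u v → h v ≤ suc (h u)) →
    (∃[ u ] ∃[ v ] d + h u ≡ h v) →
    IsDiameter d
  isDiameter _≟_ d walks h lip (s , t , d+hs≡ht) = distances , s , t , attained
    where
    distances : ∀ u v → ∃[ m ] (IsDistance u v m × m ≤ d)
    distances u v =
      let n , n≤d , uv = walks u v
          m , m≤n , uv′ , min = least (walk? _≟_ u v) n uv
      in m , (uv′ , min) , ≤-trans m≤n n≤d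

    lower : ∀ n → Walk s t n → d ≤ n
    lower n st = +-cancelʳ-≤ (h s) d n
      (≤-trans (≤-reflexive d+hs≡ht) (height-walk h lip st))

    attained : IsDistance s t d
    -- The supplied walk from `s` to `t` has length at most `d`, and by `lower` at least `d`.
    attained =
      let n , n≤d , st = walks s t
      in subst (Walk s t) (≤-antisym n≤d (lower n st)) st , lower

-- Weighted graphs and their blow-ups.

-- The index type may be infinite; the vertices are the indices of positive weight.
record WeightedGraph : Set₁ where
  field
    I              : Set
    _≟_            : DecidableEquality I
    support        : List I
    support-unique : Unique support
    nbrs           : I → List I
    nbrs-unique    : ∀ i → Unique (nbrs i)
    nbrs-sym       : ∀ {i j} → j ∈ nbrs i → i ∈ nbrs j
    nbrs-irrefl    : ∀ {i} → ¬ i ∈ nbrs i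
    weight         : I → ℕ
    weight-support : ∀ {i} → 0 < weight i → i ∈ support

  weightedDegree : I → ℕ
  weightedDegree i = sum (map weight (nbrs i))

  -- Positive weight is recorded at inner indices only, since only there must a lifted walk choose a
  -- vertex.
  data Route : I → I → ℕ → Set where
    edge : ∀ {i j} → j ∈ nbrs i → Route i j 1
    via  : ∀ {i j l n} → j ∈ nbrs i → 0 < weight j → Route j l n → Route i l (suc n)

  IsBalanced : Set
  IsBalanced = ∀ {i j} → 0 < weight i → 0 < weight j → j ∈ nbrs i →
    ∣ weightedDegree i - weightedDegree j ∣ ≡ 1

  -- A route is never empty: a route from i to itself joins twins of the blow-up.
  record HasSpan (d : ℕ) : Set where
    field
      route         : ∀ {i j} → 0 < weight i → 0 < weight j → ∃[ n ] (n ≤ d × Route i j n)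
      height        : I → ℕ
      height-lip    : ∀ {i j} → j ∈ nbrs i → height j ≤ suc (height i)
      bottom top    : I
      bottom>0      : 0 < weight bottom
      top>0         : 0 < weight top
      height-top    : d + height bottom ≡ height top

module BlowUp (S : WeightedGraph) (k : ℕ) where
  open WeightedGraph S
  open DecMembership _≟_ using (_∈?_)

  -- An index of weight 0 has an empty fibre, so it leaves the graph without any positivity proof
  -- inside the vertices.
  Vertex : Set
  Vertex = Σ I λ i → Fin (k * weight i)

  fibre : I → List Vertex
  fibre i = map (i ,_) (allFin (k * weight i))

  ∈-fibre : ∀ {v j} → v ∈ fibre j → proj₁ v ≡ j
  ∈-fibre {j = j} p with ∈-map⁻ (j ,_) p
  ... | _ , _ , refl = refl

  ∈-fibres⁺ : ∀ {v js} → proj₁ v ∈ js → v ∈ concatMap fibre js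
  ∈-fibres⁺ {i , x} p = ∈-concatMap⁺ fibre (lose p (∈-map⁺ (i ,_) (∈-allFin x)))

  ∈-fibres⁻ : ∀ {v js} → v ∈ concatMap fibre js → proj₁ v ∈ js
  ∈-fibres⁻ {js = js} p =
    let j , j∈js , v∈j = find (∈-concatMap⁻ fibre p)
    in subst (_∈ js) (sym (∈-fibre v∈j)) j∈js

  fibres-unique : ∀ {js} → Unique js → Unique (concatMap fibre js)
  fibres-unique {js} js! = Unique.concat⁺
    (All.map⁺ (All.universal (λ j → Unique.map⁺ (λ { refl → refl }) (Unique.allFin⁺ _)) js))
    (AllPairs.map⁺ (AllPairs.map
      (λ i≢j {_} (p , q) → i≢j (trans (sym (∈-fibre p)) (∈-fibre q))) js!))

  length-fibres : ∀ js → length (concatMap fibre js) ≡ k * sum (map weight js)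
  length-fibres []       = sym (*-zeroʳ k)
  length-fibres (j ∷ js) = begin
    length (concatMap fibre (j ∷ js))
      ≡⟨ length-++ (fibre j) ⟩
    length (fibre j) + length (concatMap fibre js)
      ≡⟨ cong₂ _+_ (trans (length-map _ (allFin (k * weight j))) (length-tabulate id))
                   (length-fibres js) ⟩
    k * weight j + k * sum (map weight js)
      ≡⟨ *-distribˡ-+ k (weight j) _ ⟨
    k * (weight j + sum (map weight js))
      ∎
    where open ≡-Reasoning

  weight>0 : (v : Vertex) → 0 < weight (proj₁ v)
  weight>0 (i , x) = n≢0⇒n>0 λ w≡0 →
    Fin.¬Fin0 (subst Fin (trans (cong (k *_) w≡0) (*-zeroʳ k)) x)

  graph : Graph
  graph = record
    { V        = Vertex
    ; vertices = concatMap fibre support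
    ; complete = λ v → ∈-fibres⁺ (weight-support (weight>0 v))
    ; unique   = fibres-unique support-unique
    ; Adj      = λ u v → proj₁ v ∈ nbrs (proj₁ u)
    ; Adj?     = λ u v → proj₁ v ∈? nbrs (proj₁ u)
    ; sym      = nbrs-sym
    ; irrefl   = λ { refl → nbrs-irrefl }
    }

  open Graph graph hiding (sym)

  -- The filtered vertex list and the fibres over `nbrs` are both duplicate-free with the same
  -- members, so they are permutations of each other.
  degree-weighted : ∀ v → degree v ≡ k * weightedDegree (proj₁ v)
  degree-weighted v = trans
    (↭-length (∼bag⇒↭ (unique∧set⇒bag
      (Unique.filter⁺ (Adj? v) unique)
      (fibres-unique (nbrs-unique (proj₁ v)))
      (mk⇔ (λ p → ∈-fibres⁺ (proj₂ (∈-filter⁻ (Adj? v) {xs = vertices} p)))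
           (λ p → ∈-filter⁺ (Adj? v) (complete _) (∈-fibres⁻ p))))))
    (length-fibres (nbrs (proj₁ v)))

  stepwiseIrregular : IsBalanced → IsStepwiseIrregular k
  stepwiseIrregular balanced u v uv = begin
    ∣ degree u - degree v ∣
      ≡⟨ cong₂ ∣_-_∣ (degree-weighted u) (degree-weighted v) ⟩
    ∣ k * weightedDegree (proj₁ u) - k * weightedDegree (proj₁ v) ∣
      ≡⟨ *-distribˡ-∣-∣ k _ _ ⟨
    k * ∣ weightedDegree (proj₁ u) - weightedDegree (proj₁ v) ∣
      ≡⟨ cong (k *_) (balanced (weight>0 u) (weight>0 v) uv) ⟩
    k * 1
      ≡⟨ *-identityʳ k ⟩
    k ∎
    where open ≡-Reasoning

  module _ (1≤k : 1 ≤ k) where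

    -- Here `1≤k` enters: it keeps the fibres over positive weights non-empty.
    representative : ∀ {i} → 0 < weight i → Fin (k * weight i)
    representative w>0 = fromℕ< (*-mono-≤ 1≤k w>0)

    -- Adjacency looks at indices only, so both ends may be any vertices of their fibres, in
    -- particular twins.
    lift : ∀ {i j n} → Route i j n → ∀ x y → Walk (i , x) (j , y) n
    lift (edge ij)      x y = ij ∷ []
    lift (via ij w>0 r) x y = _∷_ {v = _ , representative w>0} ij (lift r _ y)

    diameter : ∀ {d} → HasSpan d → IsDiameter d
    diameter {d} span = isDiameter graph (≡-dec _≟_ Fin._≟_) d
      (λ u v → let n , n≤d , r = route (weight>0 u) (weight>0 v) in n , n≤d , lift r _ _)
      (height ∘ proj₁)
      (λ u v → height-lip)
      ((bottom , representative bottom>0) , (top , representative top>0) , height-top)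
      where open HasSpan span

  realizes : 1 ≤ k → ∀ {d} → IsBalanced → HasSpan d →
    ∃[ G ] (Graph.IsStepwiseIrregular G k × Graph.IsDiameter G d)
  realizes 1≤k balanced span = graph , stepwiseIrregular balanced , diameter 1≤k span

-- Weighted paths

nth : List ℕ → ℕ → ℕ
-- The default 0 makes every index past the end weightless, hence absent from the blow-up.
nth []       _       = 0
nth (x ∷ xs) zero    = x
nth (x ∷ xs) (suc i) = nth xs i

nth>0⇒< : ∀ xs {i} → 0 < nth xs i → i < length xs
nth>0⇒< (x ∷ xs) {zero}  _ = s≤s z≤n
nth>0⇒< (x ∷ xs) {suc i} p = s≤s (nth>0⇒< xs p)

nth-All : ∀ {p} {P : Pred ℕ p} {xs} → All P xs → ∀ {i} → i < length xs → P (nth xs i)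
nth-All (px ∷ pxs) {zero}  _   = px
nth-All (px ∷ pxs) {suc i} i<n = nth-All pxs (s≤s⁻¹ i<n)

<⇒+ : ∀ {i j} → i < j → ∃[ n ] n + suc i ≡ j
<⇒+ {i} i<j = let n , eq = m≤n⇒∃[o]m+o≡n i<j in n , trans (+-comm n (suc i)) eq

-- In a window a, b, c, e the sums a + c and b + e are the weighted degrees of the neighbours
-- carrying b and c. In `last` the fourth entry is the 0 after the path, which is not in the list.
data Alternating : List ℕ → Set where
  last : ∀ {a b c} → ∣ (a + c) - (b + 0) ∣ ≡ 1 → Alternating (a ∷ b ∷ c ∷ [])
  _∷_  : ∀ {a b c e xs} → ∣ (a + c) - (b + e) ∣ ≡ 1 →
         Alternating (b ∷ c ∷ e ∷ xs) → Alternating (a ∷ b ∷ c ∷ e ∷ xs)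

-- The window may reach one place past the end, where the default of `nth` agrees with the 0 in
-- `last`.
alternating-nth : ∀ {xs} → Alternating xs → ∀ i → 2 + i < length xs →
  ∣ (nth xs i + nth xs (2 + i)) - (nth xs (1 + i) + nth xs (3 + i)) ∣ ≡ 1
alternating-nth (last p) zero    _   = p
alternating-nth (last p) (suc i) i<n = ⊥-elim (<⇒≱ i<n (s≤s (s≤s (s≤s z≤n))))
alternating-nth (p ∷ ps) zero    _   = p
alternating-nth (p ∷ ps) (suc i) i<n = alternating-nth ps i (s≤s⁻¹ i<n)

-- The infinite ray on ℕ; weights vanishing at 0 and past the end cut the finite path out of it.
adjacent : ℕ → List ℕ
adjacent zero    = 1 ∷ []
adjacent (suc i) = i ∷ 2 + i ∷ []

suc-adjacent : ∀ i → suc i ∈ adjacent i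
suc-adjacent zero    = here refl
suc-adjacent (suc i) = there (here refl)

adjacent-sym : ∀ {i j} → j ∈ adjacent i → i ∈ adjacent j
adjacent-sym {zero}  (here refl)         = here refl
adjacent-sym {suc i} (here refl)         = suc-adjacent i
adjacent-sym {suc i} (there (here refl)) = here refl

adjacent-irrefl : ∀ {i} → ¬ i ∈ adjacent i
adjacent-irrefl {zero}  (here ())
adjacent-irrefl {suc i} (here ())
adjacent-irrefl {suc i} (there (here ()))

adjacent-unique : ∀ i → Unique (adjacent i)
adjacent-unique zero    = [] ∷ []
adjacent-unique (suc i) = ((λ ()) ∷ []) ∷ [] ∷ []

module Path (ws : List ℕ) where

  -- Index 0 carries weight 0, so that both neighbours of every vertex are indices.
  path : WeightedGraph
  path = record
    { I              = ℕ
    ; _≟_            = _≟ℕ_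
    ; support        = upTo (length (0 ∷ ws))
    ; support-unique = Unique.upTo⁺ _
    ; nbrs           = adjacent
    ; nbrs-unique    = adjacent-unique
    ; nbrs-sym       = adjacent-sym
    ; nbrs-irrefl    = adjacent-irrefl
    ; weight         = nth (0 ∷ ws)
    ; weight-support = λ p → ∈-upTo⁺ (nth>0⇒< (0 ∷ ws) p)
    }

  open WeightedGraph path using (weight; weightedDegree; Route; edge; via; IsBalanced; HasSpan)

  weightedDegree-suc : ∀ i → weightedDegree (suc i) ≡ weight i + weight (2 + i)
  weightedDegree-suc i = cong (weight i +_) (+-identityʳ _)

  module _ (alt : Alternating (0 ∷ ws)) where

    ascending : ∀ i → 0 < weight (2 + i) →
      ∣ weightedDegree (1 + i) - weightedDegree (2 + i) ∣ ≡ 1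
    ascending i w>0 = trans
      (cong₂ ∣_-_∣ (weightedDegree-suc i) (weightedDegree-suc (1 + i)))
      (alternating-nth alt i (nth>0⇒< (0 ∷ ws) w>0))

    balanced : IsBalanced
    -- Index 0 has weight 0, so both ends of the edge are successors.
    balanced {suc i} {suc j} _ w>0 (there (here refl)) = ascending i w>0
    balanced {suc i} {suc j} w>0 _ (here refl) =
      trans (∣-∣-comm (weightedDegree (1 + i)) (weightedDegree (1 + j))) (ascending j w>0)

  module _ (positive : All (0 <_) ws) where

    weight-suc>0 : ∀ {i} → i < length ws → 0 < weight (suc i)
    weight-suc>0 = nth-All positive

    up : ∀ n i → n + i < length ws → Route i (suc n + i) (suc n)
    up zero    i _   = edge (suc-adjacent i)
    up (suc n) i n+i<l =
      via (suc-adjacent i) (weight-suc>0 (≤-trans (s≤s (m≤n+m i (suc n))) n+i<l))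
        (subst (λ j → Route (suc i) (suc j) (suc n)) (+-suc n i)
          (up n (suc i) (subst (_< length ws) (sym (+-suc n i)) n+i<l)))

    down : ∀ n i → n + i < length ws → Route (2 + n + i) (suc i) (suc n)
    down zero    i _     = edge (here refl)
    down (suc n) i n+i<l = via (here refl) (weight-suc>0 n+i<l)
      (down n i (≤-trans (n≤1+n _) n+i<l))

    module _ {d} (length≡ : length ws ≡ suc d) (2≤d : 2 ≤ d) where

      Reachable : ℕ → ℕ → Set
      Reachable i j = ∃[ n ] (n ≤ d × Route i j n)

      -- Twins are not adjacent, so they are joined through a neighbour: the right one at the left
      -- end of the path, the left one elsewhere.
      twins : ∀ i → i ≤ d → Reachable (suc i) (suc i)
      twins zero    _   = 2 , 2≤d , via (there (here refl))
        (weight-suc>0 (subst (1 <_) (sym length≡) (s≤s (<⇒≤ 2≤d)))) (edge (here refl))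
      twins (suc i) i<d = 2 , 2≤d , via (here refl)
        (weight-suc>0 (subst (i <_) (sym length≡) (s≤s (<⇒≤ i<d)))) (edge (there (here refl)))

      ≤d : ∀ {i} → 0 < weight (suc i) → i ≤ d
      ≤d w>0 = s≤s⁻¹ (subst (_ <_) length≡ (nth>0⇒< ws w>0))

      connect : ∀ i j → i ≤ d → j ≤ d → Reachable (suc i) (suc j)
      connect i j i≤d j≤d with <-cmp i j
      ... | tri≈ _ refl _ = twins i i≤d
      ... | tri< i<j _ _ with <⇒+ i<j
      ...   | n , refl = suc n ,
        ≤-trans (s≤s (m≤m+n n i)) (subst (_≤ d) (+-suc n i) j≤d) ,
        up n (suc i) (subst (n + suc i <_) (sym length≡) (s≤s j≤d))
      connect i j i≤d j≤d | tri> _ _ j<i with <⇒+ j<i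
      ...   | n , refl = suc n ,
        ≤-trans (s≤s (m≤m+n n j)) (subst (_≤ d) (+-suc n j) i≤d) ,
        subst (λ i → Route (suc i) (suc j) (suc n)) (sym (+-suc n j))
          (down n j (subst (n + j <_) (sym length≡)
            (s≤s (≤-trans (+-monoʳ-≤ n (n≤1+n j)) i≤d))))

      span : HasSpan d
      span = record
        { route      = λ { {suc i} {suc j} wi>0 wj>0 → connect i j (≤d wi>0) (≤d wj>0) }
        ; height     = id
        ; height-lip = height-lip
        -- Indices 1 and d + 1 carry the first and the last weight.
        ; bottom     = 1
        ; top        = suc d
        ; bottom>0   = weight-suc>0 (subst (0 <_) (sym length≡) (s≤s z≤n))
        ; top>0      = weight-suc>0 (subst (d <_) (sym length≡) ≤-refl)
        ; height-top = +-comm d 1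
        }
        where
        height-lip : ∀ {i j} → j ∈ adjacent i → j ≤ suc i
        height-lip {zero}  (here refl)         = ≤-refl
        height-lip {suc i} (here refl)         = ≤-trans (n≤1+n _) (n≤1+n _)
        height-lip {suc i} (there (here refl)) = ≤-refl

-- Weights for paths of length 2 and of length at least 4.

record PathWeights (d : ℕ) : Set where
  field
    weights     : List ℕ
    length≡     : length weights ≡ suc d
    positive    : All (0 <_) weights
    alternating : Alternating (0 ∷ weights)

-- Every window inside the doubled block is a cyclic rotation of a, b, c, e. Rotating by one place
-- only swaps the two sums being compared.
repeatHead : ∀ n → PathWeights (4 + n) → PathWeights (8 + n)
repeatHead n record
  { weights = a ∷ b ∷ c ∷ e ∷ x ∷ xs ; length≡ = l
  ; positive = a>0 ∷ b>0 ∷ c>0 ∷ e>0 ∷ xs>0 ; alternating = p ∷ q ∷ ps } = record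
  { weights     = a ∷ b ∷ c ∷ e ∷ a ∷ b ∷ c ∷ e ∷ x ∷ xs
  ; length≡     = cong (4 +_) l
  ; positive    = a>0 ∷ b>0 ∷ c>0 ∷ e>0 ∷ a>0 ∷ b>0 ∷ c>0 ∷ e>0 ∷ xs>0
  -- After `r₃` the second copy of the block is reached, and from there the old windows `q` and `ps`
  -- resume.
  ; alternating = p ∷ q ∷ r₁ ∷ r₂ ∷ r₃ ∷ q ∷ ps
  }
  where
  rotate : ∀ a b c e → ∣ (a + c) - (b + e) ∣ ≡ 1 → ∣ (b + e) - (c + a) ∣ ≡ 1
  rotate a b c e p = trans (∣-∣-comm (b + e) (c + a))
    (trans (cong (λ s → ∣ s - b + e ∣) (+-comm c a)) p)

  r₁ = rotate a b c e q
  r₂ = rotate b c e a r₁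
  r₃ = rotate c e a b r₂

byChecking : ∀ {d} ws → length ws ≡ suc d → {True (All.all? (0 <?_) ws)} →
  Alternating (0 ∷ ws) → PathWeights d
byChecking ws l {pos} alt = record
  { weights = ws ; length≡ = l ; positive = toWitness pos ; alternating = alt }

-- One base case for each residue of d modulo 4. The weighted degrees along them are 2, 3, 4, 3, 2;
-- then 2, 3, 4, 5, 4, 3; then 2, 3, 4, 3, 4, 3, 2; then 2, 3, 4, 3, 4, 5, 4, 3.
pathWeights : ∀ n → PathWeights (4 + n)
pathWeights 0 = byChecking (1 ∷ 2 ∷ 2 ∷ 2 ∷ 1 ∷ []) refl
  (refl ∷ refl ∷ refl ∷ last refl)
pathWeights 1 = byChecking (1 ∷ 2 ∷ 2 ∷ 2 ∷ 3 ∷ 2 ∷ []) refl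
  (refl ∷ refl ∷ refl ∷ refl ∷ last refl)
pathWeights 2 = byChecking (2 ∷ 2 ∷ 1 ∷ 2 ∷ 2 ∷ 2 ∷ 1 ∷ []) refl
  (refl ∷ refl ∷ refl ∷ refl ∷ refl ∷ last refl)
pathWeights 3 = byChecking (2 ∷ 2 ∷ 1 ∷ 2 ∷ 2 ∷ 2 ∷ 3 ∷ 2 ∷ []) refl
  (refl ∷ refl ∷ refl ∷ refl ∷ refl ∷ refl ∷ last refl)
pathWeights (suc (suc (suc (suc n)))) = repeatHead n (pathWeights n)

pathWeights₂ : PathWeights 2
pathWeights₂ = byChecking (2 ∷ 2 ∷ 1 ∷ []) refl
  (refl ∷ last refl)

-- Weights on K₄,₄ minus a perfect matching

module Crown where

  Index : Set
  Index = Bool × Fin 4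

  _≢?_ : ∀ (x y : Fin 4) → Dec (x ≢ y)
  x ≢? y = ¬? (x Fin.≟ y)

  crownNbrs : Index → List Index
  crownNbrs (s , x) = map (not s ,_) (filter (x ≢?_) (allFin 4))

  -- Each side has total weight 8, and an index sees the opposite side without its partner. This
  -- gives 8 - 2 = 6 on the `false` side, and 8 - 1 = 7 or 8 - 3 = 5 on the `true` side.
  crownWeight : Index → ℕ
  crownWeight (true  , _)                 = 2
  crownWeight (false , zero)              = 1
  crownWeight (false , suc zero)          = 1
  crownWeight (false , suc (suc zero))    = 3
  crownWeight (false , suc (suc (suc _))) = 3

  crownNbrs⁺ : ∀ s {x y} → x ≢ y → (not s , y) ∈ crownNbrs (s , x)
  crownNbrs⁺ s {x} {y} x≢y =
    ∈-map⁺ (not s ,_) (∈-filter⁺ (x ≢?_) (∈-allFin y) x≢y)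

  crownNbrs⁻ : ∀ {s x t y} → (t , y) ∈ crownNbrs (s , x) → t ≡ not s × x ≢ y
  crownNbrs⁻ {s} {x} p with ∈-map⁻ (not s ,_) p
  ... | y , q , refl = refl , proj₂ (∈-filter⁻ (x ≢?_) {xs = allFin 4} q)

  crownNbrs-sym : ∀ {i j} → j ∈ crownNbrs i → i ∈ crownNbrs j
  crownNbrs-sym {s , x} {t , y} p with crownNbrs⁻ {s} {x} p
  ... | refl , x≢y = subst (λ s′ → (s′ , x) ∈ crownNbrs (not s , y)) (Bool.not-involutive s)
    (crownNbrs⁺ (not s) (x≢y ∘ sym))

  crown : WeightedGraph
  crown = record
    { I              = Index
    ; _≟_            = ≡-dec Bool._≟_ Fin._≟_
    ; support        = cartesianProduct sides (allFin 4)
    ; support-unique = Unique.cartesianProduct⁺ {xs = sides}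
                         (((λ ()) ∷ []) ∷ [] ∷ []) (Unique.allFin⁺ 4)
    ; nbrs           = crownNbrs
    ; nbrs-unique    = λ (s , x) → Unique.map⁺ (λ { refl → refl })
                         (Unique.filter⁺ (x ≢?_) {xs = allFin 4} (Unique.allFin⁺ 4))
    ; nbrs-sym       = λ {i} {j} → crownNbrs-sym {i} {j}
    ; nbrs-irrefl    = λ { {s , x} p → proj₂ (crownNbrs⁻ {s} {x} p) refl }
    ; weight         = crownWeight
    ; weight-support = λ { {s , x} _ → ∈-cartesianProduct⁺ (∈-sides s) (∈-allFin x) }
    }
    where
    sides : List Bool
    sides = true ∷ false ∷ []

    ∈-sides : ∀ s → s ∈ sides
    ∈-sides true  = here refl
    ∈-sides false = there (here refl)

  open WeightedGraph crown using (weightedDegree; Route; edge; via; IsBalanced; HasSpan)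

  weightedDegree-false : ∀ x → weightedDegree (false , x) ≡ 6
  weightedDegree-false = from-yes (Fin.all? λ x → weightedDegree (false , x) ≟ℕ 6)

  weightedDegree-true : ∀ x → ∣ 6 - weightedDegree (true , x) ∣ ≡ 1
  weightedDegree-true = from-yes (Fin.all? λ x → ∣ 6 - weightedDegree (true , x) ∣ ≟ℕ 1)

  balanced : IsBalanced
  balanced {false , x} {t , y} _ _ p with refl , _ ← crownNbrs⁻ {false} {x} p
    rewrite weightedDegree-false x = weightedDegree-true y
  balanced {true , x} {t , y} _ _ p with refl , _ ← crownNbrs⁻ {true} {x} p
    rewrite weightedDegree-false y =
    trans (∣-∣-comm (weightedDegree (true , x)) 6) (weightedDegree-true x)

  -- Provides a common neighbour, on the other side, of two indices of one side.
  avoid : ∀ (x y : Fin 4) → ∃[ z ] (x ≢ z × z ≢ y)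
  avoid = from-yes (Fin.all? λ x → Fin.all? λ y → Fin.any? λ z →
    x ≢? z ×-dec z ≢? y)

  crownWeight>0 : ∀ i → 0 < crownWeight i
  crownWeight>0 (true  , _)                 = s≤s z≤n
  crownWeight>0 (false , zero)              = s≤s z≤n
  crownWeight>0 (false , suc zero)          = s≤s z≤n
  crownWeight>0 (false , suc (suc zero))    = s≤s z≤n
  crownWeight>0 (false , suc (suc (suc _))) = s≤s z≤n

  -- The case x = y is included; it joins twins.
  sameSide : ∀ s x y → Route (s , x) (s , y) 2
  sameSide s x y with avoid x y
  ... | z , x≢z , z≢y =
    via (crownNbrs⁺ s x≢z) (crownWeight>0 (not s , z))
      (edge (crownNbrs-sym {s , y} {not s , z} (crownNbrs⁺ s (z≢y ∘ sym))))

  -- Length 3 is needed for partners; adjacent pairs get the same route, since `HasSpan` asks only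
  -- for an upper bound.
  oppositeSide : ∀ s x y → Route (s , x) (not s , y) 3
  oppositeSide s x y with avoid x x
  ... | z , x≢z , _ =
    via (crownNbrs⁺ s x≢z) (crownWeight>0 (not s , z)) (sameSide (not s) z y)

  connect : ∀ i j → ∃[ n ] (n ≤ 3 × Route i j n)
  connect (true  , x) (true  , y) = 2 , n≤1+n 2 , sameSide true x y
  connect (false , x) (false , y) = 2 , n≤1+n 2 , sameSide false x y
  connect (true  , x) (false , y) = 3 , ≤-refl , oppositeSide true x y
  connect (false , x) (true  , y) = 3 , ≤-refl , oppositeSide false x y

  -- The distance from (false , zero).
  height : Index → ℕ
  height (false , zero)  = 0
  height (true  , suc _) = 1
  height (false , suc _) = 2
  height (true  , zero)  = 3

  height-lip : ∀ {i j} → j ∈ crownNbrs i → height j ≤ suc (height i)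
  height-lip {s , x} {t , y} p with crownNbrs⁻ {s} {x} p
  -- Only these partners differ in height by 3, and the matching edge between them has been removed.
  height-lip {false , zero}  {true , zero}   _ | refl , x≢y = ⊥-elim (x≢y refl)
  height-lip {false , zero}  {true , suc _}  _ | refl , _ = ≤-refl
  height-lip {false , suc _} {true , zero}   _ | refl , _ = ≤-refl
  height-lip {false , suc _} {true , suc _}  _ | refl , _ = s≤s z≤n
  height-lip {true , zero}   {false , zero}  _ | refl , _ = z≤n
  height-lip {true , zero}   {false , suc _} _ | refl , _ = s≤s (s≤s z≤n)
  height-lip {true , suc _}  {false , zero}  _ | refl , _ = z≤n
  height-lip {true , suc _}  {false , suc _} _ | refl , _ = ≤-refl

  span : HasSpan 3
  span = record
    { route      = λ {i} {j} _ _ → connect i j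
    ; height     = height
    ; height-lip = λ {i} {j} → height-lip {i} {j}
    ; bottom     = false , zero
    ; top        = true , zero
    ; bottom>0   = s≤s z≤n
    ; top>0      = s≤s z≤n
    ; height-top = refl
    }

-- The choice of weighted graph for each diameter.

pathRealizes : ∀ k → 1 ≤ k → ∀ d → 2 ≤ d → PathWeights d →
  ∃[ G ] (Graph.IsStepwiseIrregular G k × Graph.IsDiameter G d)
pathRealizes k 1≤k d 2≤d P =
  BlowUp.realizes path k 1≤k (balanced alternating) (span positive length≡ 2≤d)
  where
  open PathWeights P
  open Path weights

theorem3p3 : (k : ℕ) → 1 ≤ k → (d : ℕ) → 2 ≤ d →
    ∃[ G ] (Graph.IsStepwiseIrregular G k × Graph.IsDiameter G d)
theorem3p3 k 1≤k 1 (s≤s ())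
theorem3p3 k 1≤k 2 2≤d = pathRealizes k 1≤k 2 2≤d pathWeights₂
-- On a path with positive weights a, b, c, e, the two outer edges force a = e = 1 and b = c, and
-- then the two inner weighted degrees coincide. Hence the crown.
theorem3p3 k 1≤k 3 2≤d = BlowUp.realizes Crown.crown k 1≤k Crown.balanced Crown.span
theorem3p3 k 1≤k (suc (suc (suc (suc n)))) 2≤d = pathRealizes k 1≤k (4 + n) 2≤d (pathWeights n)
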